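{- Let $H$ be an Arf numerical semigroup and let $\mathcal{A}(H)$ be the set of all Arf numerical semigroups containing $H$. Then $\langle \mathcal{A}(H)\rangle=\langle\{H\}\rangle$, where $\langle\mathcal{F}\rangle$ denotes the variety generated by a family $\mathcal{F}$ of numerical semigroups.
   Context: $\mathbb{N}$ is the set of non-negative integers. A numerical semigroup is a subset $H\subseteq\mathbb{N}$ that contains $0$, is closed under addition, and has finite complement in $\mathbb{N}$. It is Arf if $2a-b\in H$ for all $a,b\in H$ with $a\ge b$. A nonempty family $\Psi$ of numerical semigroups is a variety if: (1) $S\in\Psi$ and $S\subseteq S'$ with $S'$ a numerical semigroup imply $S'\in\Psi$; and (2) $S,S'\in\Psi$ implies $S\cap S'\in\Psi$. For a family $\mathcal{F}$ of numerical semigroups, $\langle\mathcal{F}\rangle$ is the intersection of all varieties containing $\mathcal{F}$; it is the smallest variety containing $\mathcal{F}$. -}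

module Defs where

open import Level using (Level; 0ℓ; _⊔_) renaming (suc to lsuc)
open import Data.Nat using (ℕ; _+_; _*_; _∸_; _≥_; _≟_)
open import Data.List using (List; _++_)
open import Data.List.Membership.Propositional using () renaming (_∈_ to _∈ˡ_)
open import Data.List.Membership.Propositional.Properties using (∈-++⁺ˡ; ∈-++⁺ʳ)
open import Data.List.Membership.DecPropositional _≟_ using () renaming (_∈?_ to _∈ˡ?_)
open import Data.Product using (∃; _×_; _,_)
open import Relation.Nullary.Decidable using (decidable-stable)
open import Relation.Unary using (Pred; _∈_; _⊆_; _∩_; _≐_; ∁; Satisfiable)

private
  variable
    a ℓ : Level

Finite : Pred ℕ 0ℓ → Set
Finite P = ∃ λ (xs : List ℕ) → P ⊆ (_∈ˡ xs)

record NumericalSemigroup : Set₁ where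
  field
    carrier           : Pred ℕ 0ℓ
    0∈                : 0 ∈ carrier
    +-closed          : ∀ {m n} → m ∈ carrier → n ∈ carrier → m + n ∈ carrier
    finite-complement : Finite (∁ carrier)

open NumericalSemigroup public using (carrier)

_⊆ₛ_ : NumericalSemigroup → NumericalSemigroup → Set
S ⊆ₛ T = carrier S ⊆ carrier T

-- Equality of numerical semigroups is equality of their underlying sets; the
-- proof fields of the record, and the choice of predicate, are irrelevant.
_≐ₛ_ : NumericalSemigroup → NumericalSemigroup → Set
S ≐ₛ T = carrier S ≐ carrier T

_∩ₛ_ : NumericalSemigroup → NumericalSemigroup → NumericalSemigroup
S ∩ₛ T = record
  { carrier           = carrier S ∩ carrier T
  ; 0∈                = S.0∈ , T.0∈
  ; +-closed          = λ { (p , q) (p′ , q′) → S.+-closed p p′ , T.+-closed q q′ }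
  ; finite-complement = complement S.finite-complement T.finite-complement
  }
  where
  module S = NumericalSemigroup S
  module T = NumericalSemigroup T

  complement : Finite (∁ (carrier S)) → Finite (∁ (carrier T)) →
               Finite (∁ (carrier S ∩ carrier T))
  complement (xs , f) (ys , g) = xs ++ ys , λ {n} n∉ →
    decidable-stable (n ∈ˡ? (xs ++ ys)) λ n∉xs++ys →
      n∉xs++ys (∈-++⁺ˡ (f λ n∈S →
        n∉xs++ys (∈-++⁺ʳ xs (g λ n∈T → n∉ (n∈S , n∈T)))))

-- The truncated subtraction is exact, since a ≥ b gives 2 * a ≥ b.
Arf : NumericalSemigroup → Set
Arf H = ∀ {a b} → a ∈ carrier H → b ∈ carrier H → a ≥ b → 2 * a ∸ b ∈ carrier H

Family : (ℓ : Level) → Set (lsuc 0ℓ ⊔ lsuc ℓ)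
Family ℓ = Pred NumericalSemigroup ℓ

record IsVariety (Ψ : Family ℓ) : Set (lsuc 0ℓ ⊔ ℓ) where
  field
    nonempty      : Satisfiable Ψ
    upward-closed : ∀ {S S′} → S ∈ Ψ → S ⊆ₛ S′ → S′ ∈ Ψ
    ∩-closed      : ∀ {S S′} → S ∈ Ψ → S′ ∈ Ψ → (S ∩ₛ S′) ∈ Ψ

-- The intersection of all varieties containing ℱ. Agda being predicative, the
-- varieties range over the families of a given universe level ℓ.
⟨_⟩[_] : Family a → (ℓ : Level) → Family (lsuc 0ℓ ⊔ a ⊔ lsuc ℓ)
⟨ ℱ ⟩[ ℓ ] S = (Ψ : Family ℓ) → IsVariety Ψ → ℱ ⊆ Ψ → S ∈ Ψ

𝒜 : NumericalSemigroup → Family 0ℓ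
𝒜 H S = Arf S × H ⊆ₛ S

-- The singleton family { H }, up to equality of underlying sets.
⟦_⟧ : NumericalSemigroup → Family 0ℓ
⟦ H ⟧ S = S ≐ₛ H

{-# OPTIONS --safe #-}
module Submission where

open import Defs
open import Level using (Level)
open import Data.Product using (_,_; proj₂)
open import Function using (id)
open import Relation.Unary using (_≐_)

-- The same varieties contain either family: one containing `H` contains all of `𝒜 H` by upward
-- closure, and `H`, being Arf, is itself the least member of `𝒜 H`.

theorem3p22 : (ℓ : Level) (H : NumericalSemigroup) → Arf H →
    ⟨ 𝒜 H ⟩[ ℓ ] ≐ ⟨ ⟦ H ⟧ ⟩[ ℓ ]
theorem3p22 ℓ H arf = to , from
  where
  open IsVariety

  to : ∀ {S} → ⟨ 𝒜 H ⟩[ ℓ ] S → ⟨ ⟦ H ⟧ ⟩[ ℓ ] S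
  to S∈⟨𝒜⟩ Ψ variety ⟦H⟧⊆Ψ = S∈⟨𝒜⟩ Ψ variety λ {T} (_ , H⊆T) →
    upward-closed variety {H} {T} (⟦H⟧⊆Ψ {H} (id , id)) H⊆T

  from : ∀ {S} → ⟨ ⟦ H ⟧ ⟩[ ℓ ] S → ⟨ 𝒜 H ⟩[ ℓ ] S
  from S∈⟨H⟩ Ψ variety 𝒜⊆Ψ = S∈⟨H⟩ Ψ variety λ {T} T≐H →
    -- `T` may be a different record with the same underlying set as `H`; upward closure along
    -- `H ⊆ₛ T` carries membership in `Ψ` over to it.
    upward-closed variety {H} {T} (𝒜⊆Ψ {H} (arf , id)) (proj₂ T≐H)
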